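{- Let $n \geq 3$ be a prime and let $G$ be the graph $G=G_n$ on $2n^2-n$ vertices defined in the context. Then \[ \chi_{\ell}(G^2) - \chi(G^2) \geq n-1. \]
   Context: Graphs are finite and simple. $[n]=\{1,\dots,n\}$. The square $G^2$ of a graph $G$ has vertex set $V(G)$, and two distinct vertices are adjacent in $G^2$ iff their distance in $G$ is at most $2$. $\chi$ is the chromatic number. The list chromatic number $\chi_\ell(H)$ is the least $k$ such that for every assignment $L$ of lists of colors with $|L(v)|\ge k$ for all $v\in V(H)$ there is a proper coloring $\phi$ of $H$ with $\phi(v)\in L(v)$ for all $v$. Construction of $G$ (for a prime $n\ge 3$). For $i\in[n-1]$ and $(j,k)\in[n]\times[n]$ let $L_i(j,k)\in[n]$ be the unique element of $[n]$ congruent to $j+i(k-1)$ modulo $n$. The vertex set of $G$ consists of $2n^2-n$ distinct vertices: $V(G)=P_1\cup\cdots\cup P_n\cup Q_1\cup\cdots\cup Q_{n-1}$, where $P_i=\{v_{i,1},\dots,v_{i,n}\}$ for $1\le i\le n$ and $Q_j=\{w_{j,1},\dots,w_{j,n}\}$ for $1\le j\le n-1$. For $1\le j\le n$ let $T_j=\{v_{1,j},v_{2,j},\dots,v_{n,j}\}$. The edge set is $E(G)=E_1\cup E_2$, where $E_1=\bigcup_{i\in[n-1]}\bigcup_{j\in[n]}\{w_{i,j}v_{k,L_i(j,k)}:1\le k\le n\}$ and $E_2=\bigcup_{j\in[n]}\{xy: x,y\in T_j,\ x\ne y\}$. -}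

module Defs where

open import Data.Fin.Base using (Fin; toℕ)
open import Data.Fin.Properties using (*↔×; +↔⊎)
open import Data.List.Base using (List; length)
open import Data.List.Membership.Propositional using (_∈_)
open import Data.List.Relation.Unary.Unique.Propositional using (Unique)
open import Data.Nat.Base using (ℕ; suc; _+_; _*_; _∸_; _^_; _≤_; NonZero)
open import Data.Nat.DivMod using (_mod_)
open import Data.Nat.Properties using (+-∸-assoc; *-distribʳ-∸; *-identityˡ; *-identityʳ; +-identityʳ; m≤n*m)
open import Data.Product.Base using (_×_; _,_; ∃-syntax)
open import Data.Product.Function.NonDependent.Propositional using (_×-↔_)
open import Data.Sum.Base using (_⊎_; inj₁; inj₂)
open import Data.Sum.Function.Propositional using (_⊎-↔_)
open import Function.Base using (_∘_)
open import Function.Bundles using (_↔_; mk↔ₛ′)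
open import Function.Properties.Inverse using (↔-sym; ↔-trans)
open import Level using (0ℓ)
open import Relation.Binary.Definitions using (Symmetric; Irreflexive)
open import Relation.Binary.PropositionalEquality
open import Relation.Unary using (Pred)

Least : Pred ℕ 0ℓ → Pred ℕ 0ℓ
Least P k = P k × (∀ m → P m → k ≤ m)

record Graph : Set₁ where
  infix 4 _~_
  field
    V      : Set
    order  : ℕ
    finite : V ↔ Fin order
    _~_    : V → V → Set
    ~-sym    : Symmetric _~_
    ~-irrefl : Irreflexive _≡_ _~_

module _ (G : Graph) where
  open Graph G

  data Walk : V → V → ℕ → Set where
    []  : ∀ {x} → Walk x x 0
    _∷_ : ∀ {x y z ℓ} → x ~ y → Walk y z ℓ → Walk x z (suc ℓ)

  snoc : ∀ {x y z ℓ} → Walk x y ℓ → y ~ z → Walk x z (suc ℓ)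
  snoc []      e = e ∷ []
  snoc (d ∷ p) e = d ∷ snoc p e

  reverse : ∀ {x y ℓ} → Walk x y ℓ → Walk y x ℓ
  reverse []      = []
  reverse (e ∷ p) = snoc (reverse p) (~-sym e)

  -- A relation rather than a function: vertices in different components have
  -- no distance.
  IsDistance : V → V → ℕ → Set
  IsDistance x y = Least (Walk x y)

  square : Graph
  square = record
    { V        = V
    ; order    = order
    ; finite   = finite
    ; _~_      = λ x y → x ≢ y × (∃[ d ] IsDistance x y d × d ≤ 2)
    ; ~-sym    = λ { (x≢y , d , (p , min) , d≤2) →
                     x≢y ∘ sym , d , (reverse p , λ m → min m ∘ reverse) , d≤2 }
    ; ~-irrefl = λ { x≡y (x≢y , _) → x≢y x≡y }
    }

  Proper : {C : Set} → (V → C) → Set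
  Proper φ = ∀ {x y} → x ~ y → φ x ≢ φ y

  Colorable : ℕ → Set
  Colorable k = ∃[ φ ] Proper {Fin k} φ

  -- Colors are natural numbers, and the finite color set L(x) is a
  -- duplicate-free list, so that its length is its cardinality.
  Choosable : ℕ → Set
  Choosable k =
    (L : V → List ℕ) → (∀ x → Unique (L x)) → (∀ x → k ≤ length (L x)) →
    ∃[ φ ] Proper φ × (∀ x → φ x ∈ L x)

  IsChromaticNumber : ℕ → Set
  IsChromaticNumber = Least Colorable

  IsListChromaticNumber : ℕ → Set
  IsListChromaticNumber = Least Choosable

-- An element a of [n] is encoded as the a' : Fin n with a = toℕ a' + 1, and
-- likewise for [n-1].
data Vertex (n : ℕ) : Set where
  v : Fin n → Fin n → Vertex n
  w : Fin (n ∸ 1) → Fin n → Vertex n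

Vertex-finite : ∀ n → Vertex n ↔ Fin (n * n + (n ∸ 1) * n)
Vertex-finite n = ↔-trans
  (mk↔ₛ′ {B = (Fin n × Fin n) ⊎ (Fin (n ∸ 1) × Fin n)}
    (λ { (v i j) → inj₁ (i , j) ; (w i j) → inj₂ (i , j) })
    (λ { (inj₁ (i , j)) → v i j ; (inj₂ (i , j)) → w i j })
    (λ { (inj₁ _) → refl ; (inj₂ _) → refl })
    (λ { (v _ _) → refl ; (w _ _) → refl }))
  (↔-trans (↔-sym *↔× ⊎-↔ ↔-sym *↔×) (↔-sym +↔⊎))

module _ (n : ℕ) .{{_ : NonZero n}} where

  -- With i = i' + 1, j = j' + 1, k = k' + 1, the residue j + i(k - 1) has
  -- representative j' + (i' + 1) k' + 1 before reduction to [n]; the final + 1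
  -- is absorbed by the encoding of the result.
  L : Fin (n ∸ 1) → Fin n → Fin n → Fin n
  L i j k = (toℕ j + suc (toℕ i) * toℕ k) mod n

  data Edge : Vertex n → Vertex n → Set where
    e₁  : ∀ i j k → Edge (w i j) (v k (L i j k))
    e₁˘ : ∀ i j k → Edge (v k (L i j k)) (w i j)
    e₂  : ∀ {i i′} j → i ≢ i′ → Edge (v i j) (v i′ j)

  G : Graph
  G = record
    { V        = Vertex n
    ; order    = n * n + (n ∸ 1) * n
    ; finite   = Vertex-finite n
    ; _~_      = Edge
    ; ~-sym    = λ { (e₁ i j k) → e₁˘ i j k ; (e₁˘ i j k) → e₁ i j k
                   ; (e₂ j i≢i′) → e₂ j (i≢i′ ∘ sym) }
    ; ~-irrefl = λ { refl (e₂ j i≢i) → i≢i refl }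
    }

  G-order : Graph.order G ≡ 2 * n ^ 2 ∸ n
  G-order = begin
    n * n + (n ∸ 1) * n       ≡⟨ cong (n * n +_) (*-distribʳ-∸ n n 1) ⟩
    n * n + (n * n ∸ 1 * n)   ≡⟨ cong (λ x → n * n + (n * n ∸ x)) (*-identityˡ n) ⟩
    n * n + (n * n ∸ n)       ≡⟨ +-∸-assoc (n * n) (m≤n*m n n) ⟨
    (n * n + n * n) ∸ n       ≡⟨ cong (λ x → (x + x) ∸ n) (cong (n *_) (*-identityʳ n)) ⟨
    (n ^ 2 + n ^ 2) ∸ n       ≡⟨ cong (λ x → (n ^ 2 + x) ∸ n) (+-identityʳ (n ^ 2)) ⟨
    2 * n ^ 2 ∸ n             ∎
    where open ≡-Reasoning

{-# OPTIONS --safe #-}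

-- Two vertices of G² are adjacent exactly when they lie in different sets among
-- P₁, …, Pₙ, Q₁, …, Qₙ₋₁: in the affine plane over 𝔽ₙ, the graphs of k ↦ Lᵢ(j,k)
-- are the lines of slope i ≠ 0, and the Tⱼ are the lines of slope 0. Hence G² is complete multipartite with r = 2n - 1
-- parts of size n, and χ(G²) ≤ 2n - 1. Split 3n colors into n blocks of size 3
-- and give the j-th vertex of every part all colors outside the j-th block.
-- These lists have size 3(n - 1). As no color lies in all the lists of a part,
-- each part uses at least two colors, and different parts share none: a coloring
-- needs 2(2n - 1) > 3n colors, so χ_ℓ(G²) ≥ 3(n - 1) + 1.
module Submission where

open import Data.Nat using (ℕ; NonZero; _≤_)
open import Data.Nat.Primality using (Prime)
open import Data.Integer using (+_; _-_; _≥_)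
open import Defs

open import Data.Empty using (⊥-elim)
open import Data.Fin.Base as Fin
  using (Fin; zero; suc; toℕ; _↑ˡ_; _↑ʳ_; splitAt; combine; remQuot; quotient; remainder; punchIn; punchOut)
open import Data.Fin.Properties as Fin
  using (toℕ<n; toℕ-injective; toℕ-fromℕ<; any?; punchOut-injective; punchIn-injective; punchInᵢ≢i;
         injective⇒≤; combine-injective; combine-remQuot; remQuot-combine; ↑ˡ-injective; ↑ʳ-injective;
         splitAt⁻¹-↑ˡ; splitAt⁻¹-↑ʳ; splitAt-↑ˡ; splitAt-↑ʳ)
import Data.Integer.Base as ℤ
import Data.Integer.Properties as ℤ
open import Data.List.Base using (tabulate)
open import Data.List.Membership.Propositional.Properties using (∈-tabulate⁻)
open import Data.List.Properties using (length-tabulate)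
open import Data.List.Relation.Unary.Unique.Propositional.Properties using (tabulate⁺)
open import Data.Nat.Base using (zero; suc; _+_; _*_; _∸_; _<_; z≤n; s≤s; >-nonZero)
open import Data.Nat.Divisibility using (_∣_; _∤_; divides; >⇒∤)
open import Data.Nat.DivMod using (_%_; _/_; _mod_; m≡m%n+[m/n]*n; %-distribˡ-+; m<n⇒m%n≡m; m%n%n≡m%n)
open import Data.Nat.Primality using (euclidsLemma)
open import Data.Nat.Properties
open import Data.Nat.Tactic.RingSolver using (solve-∀)
open import Data.Product.Base using (_×_; _,_; ∃; ∃₂; proj₁; proj₂; uncurry)
open import Data.Sum.Base using (_⊎_; inj₁; inj₂)
open import Function.Base using (_∘_)
open import Function.Definitions using (Injective)
open import Relation.Binary.Definitions using (tri<; tri≈; tri>)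
open import Relation.Binary.PropositionalEquality
open import Relation.Nullary using (¬_; yes; no; contradiction)

-- Pigeonhole and arithmetic modulo n.

-- A missed value `y` could be punched out of the codomain, leaving an injection of `Fin (suc n)`
-- into `Fin n`.
injective⇒surjective : ∀ {n} {f : Fin n → Fin n} → Injective _≡_ _≡_ f → ∀ y → ∃ λ x → f x ≡ y
injective⇒surjective {suc n} {f} inj y with any? (λ x → f x Fin.≟ y)
... | yes fx≡y = fx≡y
... | no  fx≢y = contradiction (injective⇒≤ (λ {x} {x′} → inj ∘ punchOut-injective (y≢f x) (y≢f x′))) 1+n≰n
  where
  y≢f : ∀ x → y ≢ f x
  y≢f x y≡fx = fx≢y (x , sym y≡fx)

[m+d]%n≡m%n⇒n∣d : ∀ m d n .{{_ : NonZero n}} → (m + d) % n ≡ m % n → n ∣ d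
[m+d]%n≡m%n⇒n∣d m d n eq = divides ((m + d) / n ∸ m / n) (begin
  d                                                     ≡⟨ m+n∸m≡n m d ⟨
  (m + d) ∸ m                                           ≡⟨ cong₂ _∸_ (m≡m%n+[m/n]*n (m + d) n) (m≡m%n+[m/n]*n m n) ⟩
  ((m + d) % n + (m + d) / n * n) ∸ (m % n + m / n * n) ≡⟨ cong (λ r → (r + (m + d) / n * n) ∸ (m % n + m / n * n)) eq ⟩
  (m % n + (m + d) / n * n) ∸ (m % n + m / n * n)       ≡⟨ [m+n]∸[m+o]≡n∸o (m % n) ((m + d) / n * n) (m / n * n) ⟩
  (m + d) / n * n ∸ m / n * n                           ≡⟨ *-distribʳ-∸ n ((m + d) / n) (m / n) ⟨
  ((m + d) / n ∸ m / n) * n                             ∎)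
  where open ≡-Reasoning

%-congʳ-+ : ∀ k {m o} n .{{_ : NonZero n}} → m % n ≡ o % n → (k + m) % n ≡ (k + o) % n
%-congʳ-+ k {m} {o} n eq = begin
  (k + m) % n         ≡⟨ %-distribˡ-+ k m n ⟩
  (k % n + m % n) % n ≡⟨ cong (λ r → (k % n + r) % n) eq ⟩
  (k % n + o % n) % n ≡⟨ %-distribˡ-+ k o n ⟨
  (k + o) % n         ∎
  where open ≡-Reasoning

toℕ-mod : ∀ m n .{{_ : NonZero n}} → toℕ (m mod n) ≡ m % n
toℕ-mod m n = toℕ-fromℕ< _

mod-cong : ∀ {m o} n .{{_ : NonZero n}} → m % n ≡ o % n → m mod n ≡ o mod n
mod-cong {m} {o} n eq = toℕ-injective (trans (toℕ-mod m n) (trans eq (sym (toℕ-mod o n))))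

toℕ-% : ∀ {n} .{{_ : NonZero n}} (x : Fin n) → toℕ x % n ≡ toℕ x
toℕ-% x = m<n⇒m%n≡m (toℕ<n x)

mod-congʳ-+ : ∀ k m {n} .{{_ : NonZero n}} {x : Fin n} → m mod n ≡ x → (k + m) mod n ≡ (k + toℕ x) mod n
mod-congʳ-+ k m {n} {x} refl = mod-cong {k + m} {k + toℕ (m mod n)} n (%-congʳ-+ k {m} {toℕ (m mod n)} n (begin
  m % n               ≡⟨ m%n%n≡m%n m n ⟨
  m % n % n           ≡⟨ cong (_% n) (toℕ-mod m n) ⟨
  toℕ (m mod n) % n   ∎))
  where open ≡-Reasoning

mod-≡ : ∀ {m n} .{{_ : NonZero n}} {x : Fin n} → m % n ≡ toℕ x % n → m mod n ≡ x
mod-≡ {m} {n} {x} eq = toℕ-injective (trans (toℕ-mod m n) (trans eq (toℕ-% x)))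

0<m<n⇒n∤m : ∀ {m n} → 0 < m → m < n → n ∤ m
0<m<n⇒n∤m 0<m = >⇒∤ {{>-nonZero 0<m}}

-- Affine maps modulo a prime.

module _ {n} .{{_ : NonZero n}} (prime : Prime n) where

  -- Equality would make n divide `a * (y ∸ x)`; Euclid's lemma leaves only n dividing `y ∸ x`,
  -- which lies strictly between 0 and n.
  affine-≢ : ∀ {a} b {x y} → n ∤ a → x < y → y < n → (b + a * x) % n ≢ (b + a * y) % n
  affine-≢ {a} b {x} {y} n∤a x<y y<n eq with euclidsLemma a (y ∸ x) prime
    ([m+d]%n≡m%n⇒n∣d (b + a * x) (a * (y ∸ x)) n (trans (cong (_% n) (begin
      b + a * x + a * (y ∸ x) ≡⟨ step a b x (y ∸ x) ⟩
      b + a * (x + (y ∸ x))   ≡⟨ cong (λ z → b + a * z) (m+[n∸m]≡n (<⇒≤ x<y)) ⟩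
      b + a * y               ∎)) (sym eq)))
    where
    open ≡-Reasoning
    step : ∀ a b x d → b + a * x + a * d ≡ b + a * (x + d)
    step = solve-∀
  ... | inj₁ n∣a = n∤a n∣a
  ... | inj₂ n∣d = 0<m<n⇒n∤m (m<n⇒0<n∸m x<y) (≤-<-trans (m∸n≤m y x) y<n) n∣d

  affine-injective : ∀ {a} b → n ∤ a → Injective _≡_ _≡_ λ (x : Fin n) → (b + a * toℕ x) mod n
  affine-injective {a} b n∤a {x} {y} eq with Fin.<-cmp x y
  ... | tri< x<y _ _ = contradiction eq′ (affine-≢ b n∤a x<y (toℕ<n y))
    where eq′ = trans (sym (toℕ-mod _ n)) (trans (cong toℕ eq) (toℕ-mod _ n))
  ... | tri≈ _ x≡y _ = x≡y
  ... | tri> _ _ y<x = contradiction (sym eq′) (affine-≢ b n∤a y<x (toℕ<n x))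
    where eq′ = trans (sym (toℕ-mod _ n)) (trans (cong toℕ eq) (toℕ-mod _ n))

  affine-solve : ∀ {a} b → n ∤ a → ∀ (c : Fin n) → ∃ λ (x : Fin n) → (b + a * toℕ x) mod n ≡ c
  affine-solve b n∤a = injective⇒surjective (affine-injective b n∤a)

-- Incidence of points and lines of nonzero slope.

module _ {m} (prime : Prime (suc m)) where

  private n = suc m

  n∤slope : ∀ (i : Fin m) → n ∤ suc (toℕ i)
  n∤slope i = 0<m<n⇒n∤m (s≤s z≤n) (s≤s (toℕ<n i))

  L-reaches : ∀ i j l → ∃ λ k → L n i j k ≡ l
  L-reaches i j = affine-solve prime (toℕ j) (n∤slope i)

  -- Parallel lines are disjoint: for fixed `i` and `k` the value is affine in `j` with coefficient
  -- 1.
  L-injectiveʲ : ∀ i j j′ k → L n i j k ≡ L n i j′ k → j ≡ j′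
  L-injectiveʲ i j j′ k eq = affine-injective prime (s * toℕ k) n∤1
    (trans (cong (_mod n) (flip j)) (trans eq (cong (_mod n) (sym (flip j′)))))
    where
    s = suc (toℕ i)
    n∤1 : n ∤ 1
    -- The slope `i` inhabits `Fin m`, so 1 < n.
    n∤1 = 0<m<n⇒n∤m (s≤s z≤n) (≤-trans (s≤s (s≤s z≤n)) (s≤s (≤-trans (s≤s z≤n) (toℕ<n i))))
    step : ∀ s j k → s * k + 1 * j ≡ j + s * k
    step = solve-∀
    flip : ∀ j → s * toℕ k + 1 * toℕ j ≡ toℕ j + s * toℕ k
    flip j = step s (toℕ j) (toℕ k)

  -- Cancelling the common term `s * k` reduces the meeting condition to `j′ + d * k ≡ j`, where `d`
  -- is the difference of the slopes and is invertible modulo n.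
  lines-meet-< : ∀ {i i′} → i Fin.< i′ → ∀ j j′ → ∃ λ k → L n i j k ≡ L n i′ j′ k
  lines-meet-< {i} {i′} i<i′ j j′ = k , (begin
    (toℕ j + s * toℕ k) mod n                  ≡⟨ cong (_mod n) (+-comm (toℕ j) (s * toℕ k)) ⟩
    (s * toℕ k + toℕ j) mod n                  ≡⟨ mod-congʳ-+ (s * toℕ k) (toℕ j′ + d * toℕ k) eq ⟨
    (s * toℕ k + (toℕ j′ + d * toℕ k)) mod n   ≡⟨ cong (_mod n) (step s d (toℕ j′) (toℕ k)) ⟨
    (toℕ j′ + (s + d) * toℕ k) mod n           ≡⟨ cong (λ t → (toℕ j′ + t * toℕ k) mod n) s+d≡s′ ⟩
    (toℕ j′ + suc (toℕ i′) * toℕ k) mod n      ∎)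
    where
    open ≡-Reasoning
    s = suc (toℕ i)
    d = toℕ i′ ∸ toℕ i
    s+d≡s′ : s + d ≡ suc (toℕ i′)
    s+d≡s′ = cong suc (m+[n∸m]≡n (<⇒≤ i<i′))
    n∤d : n ∤ d
    n∤d = 0<m<n⇒n∤m (m<n⇒0<n∸m i<i′) (≤-<-trans (m∸n≤m (toℕ i′) (toℕ i)) (m<n⇒m<1+n (toℕ<n i′)))
    solution = affine-solve prime {d} (toℕ j′) n∤d j
    k = proj₁ solution
    eq = proj₂ solution
    step : ∀ s d j k → j + (s + d) * k ≡ s * k + (j + d * k)
    step = solve-∀

  lines-meet : ∀ {i i′} → i ≢ i′ → ∀ j j′ → ∃ λ k → L n i j k ≡ L n i′ j′ k
  lines-meet {i} {i′} i≢i′ j j′ with Fin.<-cmp i i′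
  ... | tri< i<i′ _ _ = lines-meet-< {i} {i′} i<i′ j j′
  ... | tri≈ _ i≡i′ _ = contradiction i≡i′ i≢i′
  ... | tri> _ _ i′<i = let k , eq = lines-meet-< {i′} {i} i′<i j′ j in k , sym eq

  -- The slope s solves `l + (k′ - k) * s ≡ l′`; then `j` is chosen so that the line passes through
  -- the first point.
  line-through-< : ∀ {k k′} → k Fin.< k′ → ∀ {l l′} → l ≢ l′ →
                   ∃₂ λ i j → L n i j k ≡ l × L n i j k′ ≡ l′
  line-through-< {k} {k′} k<k′ {l} {l′} l≢l′
    with affine-solve prime {toℕ k′ ∸ toℕ k} (toℕ l)
      (0<m<n⇒n∤m (m<n⇒0<n∸m k<k′) (≤-<-trans (m∸n≤m (toℕ k′) (toℕ k)) (toℕ<n k′))) l′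
  -- Slope 0 would force `l ≡ l′`.
  ... | zero , eq = contradiction (trans (sym (mod-≡ {toℕ l + (toℕ k′ ∸ toℕ k) * 0} (cong (_% n) l+0))) eq) l≢l′
    where
    l+0 : toℕ l + (toℕ k′ ∸ toℕ k) * 0 ≡ toℕ l
    l+0 = trans (cong (_+_ (toℕ l)) (*-zeroʳ (toℕ k′ ∸ toℕ k))) (+-identityʳ (toℕ l))
  -- A nonzero solution `suc i` is the slope that `L` encodes by `i`.
  ... | suc i , eq
    with j , eq′ ← affine-solve prime {1} (suc (toℕ i) * toℕ k)
           (0<m<n⇒n∤m (s≤s z≤n) (≤-<-trans (s≤s z≤n) (toℕ<n (Fin.suc i)))) l
    = i , j , at-k , at-k′
    where
    s = suc (toℕ i)
    d = toℕ k′ ∸ toℕ k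
    open ≡-Reasoning
    comm : ∀ s j k → j + s * k ≡ s * k + 1 * j
    comm = solve-∀
    step : ∀ s j k d → j + s * (k + d) ≡ d * s + (s * k + 1 * j)
    step = solve-∀
    at-k : L n i j k ≡ l
    at-k = trans (cong (_mod n) (comm s (toℕ j) (toℕ k))) eq′
    k+d≡k′ : toℕ k + d ≡ toℕ k′
    k+d≡k′ = m+[n∸m]≡n (<⇒≤ k<k′)
    at-k′ : L n i j k′ ≡ l′
    at-k′ = begin
      (toℕ j + s * toℕ k′) mod n                   ≡⟨ cong (λ t → (toℕ j + s * t) mod n) k+d≡k′ ⟨
      (toℕ j + s * (toℕ k + d)) mod n              ≡⟨ cong (_mod n) (step s (toℕ j) (toℕ k) d) ⟩
      (d * s + (s * toℕ k + 1 * toℕ j)) mod n      ≡⟨ mod-congʳ-+ (d * s) (s * toℕ k + 1 * toℕ j) eq′ ⟩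
      (d * s + toℕ l) mod n                        ≡⟨ cong (_mod n) (+-comm (d * s) (toℕ l)) ⟩
      (toℕ l + d * s) mod n                        ≡⟨ eq ⟩
      l′                                           ∎

  line-through : ∀ {k k′} → k ≢ k′ → ∀ {l l′} → l ≢ l′ →
                 ∃₂ λ i j → L n i j k ≡ l × L n i j k′ ≡ l′
  line-through {k} {k′} k≢k′ l≢l′ with Fin.<-cmp k k′
  ... | tri< k<k′ _ _ = line-through-< {k} {k′} k<k′ l≢l′
  ... | tri≈ _ k≡k′ _ = contradiction k≡k′ k≢k′
  ... | tri> _ _ k′<k = let i , j , eq , eq′ = line-through-< {k′} {k} k′<k (l≢l′ ∘ sym) in i , j , eq′ , eq

-- Adjacency in the square as joining by one or two edges.

module _ (H : Graph) where
  open Graph H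

  WithinTwo : V → V → Set
  WithinTwo x y = x ~ y ⊎ ∃ λ z → x ~ z × z ~ y

  square⇒withinTwo : ∀ {x y} → Graph._~_ (square H) x y → WithinTwo x y
  square⇒withinTwo (x≢y , 0 , ([] , _) , _)            = contradiction refl x≢y
  square⇒withinTwo (_   , 1 , (e ∷ [] , _) , _)        = inj₁ e
  square⇒withinTwo (_   , 2 , (e ∷ (f ∷ []) , _) , _)  = inj₂ (_ , e , f)
  square⇒withinTwo (_   , suc (suc (suc _)) , _ , s≤s (s≤s ()))

  -- The double negation spares deciding whether a walk of length 2 is shortest.
  withinTwo⇒¬¬square : ∀ {x y} → x ≢ y → WithinTwo x y → ¬ ¬ Graph._~_ (square H) x y
  withinTwo⇒¬¬square x≢y (inj₁ e) x≁y =
    x≁y (x≢y , 1 , (e ∷ [] , λ { zero [] → contradiction refl x≢y ; (suc _) _ → s≤s z≤n }) , s≤s z≤n)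
  withinTwo⇒¬¬square x≢y (inj₂ (_ , e , f)) x≁y =
    x≁y (x≢y , 2 , (e ∷ (f ∷ []) , min) , ≤-refl)
    where
    min : ∀ ℓ → Walk H _ _ ℓ → 2 ≤ ℓ
    min 0             []        = contradiction refl x≢y
    min 1             (e′ ∷ []) = ⊥-elim (withinTwo⇒¬¬square x≢y (inj₁ e′) x≁y)
    min (suc (suc _)) _         = s≤s (s≤s z≤n)

-- The square of G is complete multipartite.

module _ {m : ℕ} where

  private n = suc m

  -- The P's are numbered first, then the Q's. This map is also the proper coloring with 2n - 1
  -- colors.
  part : Vertex n → Fin (n + m)
  part (v i _) = i ↑ˡ m
  part (w i _) = n ↑ʳ i

  index : Vertex n → Fin n
  index (v _ j) = j
  index (w _ j) = j

  vertex : Fin (n + m) → Fin n → Vertex n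
  vertex p j with splitAt n p
  ... | inj₁ i = v i j
  ... | inj₂ i = w i j

  index-vertex : ∀ p j → index (vertex p j) ≡ j
  index-vertex p j with splitAt n p
  ... | inj₁ _ = refl
  ... | inj₂ _ = refl

  part-vertex : ∀ p j → part (vertex p j) ≡ p
  part-vertex p j with splitAt n p in eq
  ... | inj₁ _ = splitAt⁻¹-↑ˡ eq
  ... | inj₂ _ = splitAt⁻¹-↑ʳ eq

  ↑ˡ≢↑ʳ : ∀ {i : Fin n} {i′ : Fin m} → i ↑ˡ m ≢ n ↑ʳ i′
  ↑ˡ≢↑ʳ {i} {i′} eq with () ← trans (sym (splitAt-↑ˡ n i m)) (trans (cong (splitAt n) eq) (splitAt-↑ʳ n m i′))

  Edge-vv : ∀ {i j i′ j′} → Edge n (v i j) (v i′ j′) → i ≢ i′ × j ≡ j′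
  Edge-vv (e₂ _ i≢i′) = i≢i′ , refl

  -- Keeping `l` a variable and recording its value as an equation allows matching on edges whose
  -- endpoint contains the computed value `L n i j k`.
  Edge-wv : ∀ i j k {l} → Edge n (w i j) (v k l) → L n i j k ≡ l
  Edge-wv _ _ _ (e₁ _ _ _) = refl

  Edge-vw : ∀ i j k {l} → Edge n (v k l) (w i j) → L n i j k ≡ l
  Edge-vw _ _ _ (e₁˘ _ _ _) = refl

  wv : ∀ i j k {l} → L n i j k ≡ l → Edge n (w i j) (v k l)
  wv i j k refl = e₁ i j k

  vw : ∀ i j k {l} → L n i j k ≡ l → Edge n (v k l) (w i j)
  vw i j k refl = e₁˘ i j k

  edge⇒part≢ : ∀ {x y} → Edge n x y → part x ≢ part y
  edge⇒part≢ (e₁ _ _ _)  = ↑ˡ≢↑ʳ ∘ sym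
  edge⇒part≢ (e₁˘ _ _ _) = ↑ˡ≢↑ʳ
  edge⇒part≢ (e₂ _ i≢i′) = i≢i′ ∘ ↑ˡ-injective m _ _

  module _ (prime : Prime n) where

    -- Within some P, a common neighbour places both vertices in the same T or on one line at the
    -- same `k`, so they coincide. Within some Q, the two lines are parallel and share a point, so
    -- they coincide.
    commonNeighbour⇒part≢ : ∀ {x y} z → x ≢ y → Edge n x z → Edge n z y → part x ≢ part y
    commonNeighbour⇒part≢ {v i _} {v i′ _} z x≢y e f eq with refl ← ↑ˡ-injective m i i′ eq with z
    ... | v _ _ = x≢y (cong (v i) (trans (proj₂ (Edge-vv e)) (proj₂ (Edge-vv f))))
    ... | w i″ j″ = x≢y (cong (v i) (trans (sym (Edge-vw i″ j″ i e)) (Edge-wv i″ j″ i f)))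
    commonNeighbour⇒part≢ {v _ _} {w _ _} _ _ _ _ eq = ↑ˡ≢↑ʳ eq
    commonNeighbour⇒part≢ {w _ _} {v _ _} _ _ _ _ eq = ↑ˡ≢↑ʳ (sym eq)
    commonNeighbour⇒part≢ {w i j} {w i′ j′} (v k _) x≢y e f eq with refl ← ↑ʳ-injective n i i′ eq =
      x≢y (cong (w i) (L-injectiveʲ prime i j j′ k (trans (Edge-wv i j k e) (sym (Edge-vw i j′ k f)))))

    square⇒part≢ : ∀ {x y} → Graph._~_ (square (G n)) x y → part x ≢ part y
    square⇒part≢ s@(x≢y , _) with square⇒withinTwo (G n) s
    ... | inj₁ e           = edge⇒part≢ e
    ... | inj₂ (z , e , f) = commonNeighbour⇒part≢ z x≢y e f

    -- The line meets the clique T indexed by `l` in some vertex, which is either `v k l` itself or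
    -- adjacent to it.
    w-v-withinTwo : ∀ i j k l → WithinTwo (G n) (w i j) (v k l)
    w-v-withinTwo i j k l with k′ , eq ← L-reaches prime i j l with k′ Fin.≟ k
    ... | yes refl = inj₁ (wv i j k eq)
    ... | no  k′≢k = inj₂ (v k′ l , wv i j k′ eq , e₂ l k′≢k)

    -- Two points in different T's are joined by the line through them, and two lines of different
    -- slopes by their common point.
    part≢⇒withinTwo : ∀ x y → part x ≢ part y → WithinTwo (G n) x y
    part≢⇒withinTwo (v k l) (v k′ l′) p≢q with l Fin.≟ l′
    ... | yes refl = inj₁ (e₂ l (p≢q ∘ cong (_↑ˡ m)))
    ... | no  l≢l′ = let i , j , eq , eq′ = line-through prime {k} {k′} (p≢q ∘ cong (_↑ˡ m)) {l} {l′} l≢l′ in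
      inj₂ (w i j , vw i j k eq , wv i j k′ eq′)
    part≢⇒withinTwo (v k l) (w i j) _ with w-v-withinTwo i j k l
    ... | inj₁ e           = inj₁ (Graph.~-sym (G n) e)
    ... | inj₂ (z , e , f) = inj₂ (z , Graph.~-sym (G n) f , Graph.~-sym (G n) e)
    part≢⇒withinTwo (w i j) (v k l) _ = w-v-withinTwo i j k l
    part≢⇒withinTwo (w i j) (w i′ j′) p≢q = let k , eq = lines-meet prime {i} {i′} (p≢q ∘ cong (n ↑ʳ_)) j j′ in
      inj₂ (v k (L n i′ j′ k) , wv i j k eq , e₁˘ i′ j′ k)

    part≢⇒¬¬square : ∀ {x y} → part x ≢ part y → ¬ ¬ Graph._~_ (square (G n)) x y
    part≢⇒¬¬square p≢q = withinTwo⇒¬¬square (G n) (p≢q ∘ cong part) (part≢⇒withinTwo _ _ p≢q)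

    square-colorable : Colorable (square (G n)) (n + m)
    square-colorable = part , square⇒part≢

-- A lower bound for list colorings of complete multipartite graphs.

remQuot-injective : ∀ {n} k {x y : Fin (n * k)} → quotient {n} k x ≡ quotient {n} k y →
                    remainder {n} k x ≡ remainder {n} k y → x ≡ y
remQuot-injective {n} k {x} {y} q r =
  trans (sym (combine-remQuot {n} k x)) (trans (cong₂ combine q r) (combine-remQuot {n} k y))

module _ {m b : ℕ} where

  -- The colors form `suc m` blocks of size `b`, and `quotient b` gives the block of a color;
  -- `avoid j` enumerates the colors outside block `j`.
  avoid : Fin (suc m) → Fin (m * b) → Fin (suc m * b)
  avoid j c = combine (punchIn j (quotient b c)) (remainder {m} b c)

  avoid-injective : ∀ j {c d} → avoid j c ≡ avoid j d → c ≡ d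
  avoid-injective j eq with q , r ← combine-injective _ _ _ _ eq =
    remQuot-injective {m} b (punchIn-injective j _ _ q) r

  quotient-avoid : ∀ j c → quotient b (avoid j c) ≢ j
  quotient-avoid j c eq = punchInᵢ≢i j (quotient b c)
    (trans (sym (cong proj₁ (remQuot-combine (punchIn j (quotient b c)) (remainder {m} b c)))) eq)

  -- Two representatives per part receive pairwise distinct colors, which injects `Fin (r * 2)` into
  -- the palette.
  choosable-multipartite : ∀ (H : Graph) {k r}
    (vertex : Fin r → Fin (suc m) → Graph.V H) (index : Graph.V H → Fin (suc m)) →
    (∀ p j → index (vertex p j) ≡ j) →
    (∀ {p q} i j → p ≢ q → ¬ ¬ Graph._~_ H (vertex p i) (vertex q j)) →
    k ≤ m * b → Choosable H k → r * 2 ≤ suc m * b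
  choosable-multipartite H {r = r} vertex index index-vertex complete k≤mb choosable
    with φ , proper , φ∈L ← choosable
      (λ x → tabulate (toℕ ∘ avoid (index x)))
      (λ x → tabulate⁺ (avoid-injective (index x) ∘ toℕ-injective))
      (λ x → ≤-trans k≤mb (≤-reflexive (sym (length-tabulate (toℕ ∘ avoid (index x))))))
    = injective⇒≤ {f = color ∘ uncurry rep ∘ remQuot 2}
        λ eq → uncurry (remQuot-injective {r} 2) (color-rep-injective _ _ eq)
    where
    open Graph H
    choice : ∀ x → ∃ λ c → φ x ≡ toℕ (avoid (index x) c)
    choice x = ∈-tabulate⁻ (φ∈L x)

    -- The color `φ x` is pulled back from a natural number to the finite palette so that colors can
    -- be counted.
    color : V → Fin (suc m * b)
    color x = avoid (index x) (proj₁ (choice x))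

    color-proper : ∀ {x y} → x ~ y → color x ≢ color y
    color-proper {x} {y} e eq = proper e (trans (proj₂ (choice x)) (trans (cong toℕ eq) (sym (proj₂ (choice y)))))

    -- The second representative is the vertex of the part whose list omits the
    -- block of the first one's color.
    rep : Fin r → Fin 2 → V
    rep p zero    = vertex p zero
    rep p (suc _) = vertex p (quotient b (color (vertex p zero)))

    reps-differ : ∀ p → color (rep p zero) ≢ color (rep p (suc zero))
    reps-differ p eq = quotient-avoid _ _ (trans (cong (quotient b) (sym eq)) (sym (index-vertex p _)))

    rep-complete : ∀ {p q} s t → p ≢ q → ¬ ¬ (rep p s ~ rep q t)
    rep-complete zero    zero    = complete _ _
    rep-complete zero    (suc _) = complete _ _
    rep-complete (suc _) zero    = complete _ _
    rep-complete (suc _) (suc _) = complete _ _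

    color-rep-injective : ∀ ((p , s) (q , t) : Fin r × Fin 2) → color (rep p s) ≡ color (rep q t) → p ≡ q × s ≡ t
    color-rep-injective (p , s) (q , t) eq with p Fin.≟ q
    -- The goal here is a contradiction, so doubly negated adjacency suffices.
    ... | no p≢q = ⊥-elim (rep-complete s t p≢q λ e → color-proper e eq)
    color-rep-injective (p , zero)     (_ , zero)     _  | yes refl = refl , refl
    color-rep-injective (p , zero)     (_ , suc zero) eq | yes refl = contradiction eq (reps-differ p)
    color-rep-injective (p , suc zero) (_ , zero)     eq | yes refl = contradiction (sym eq) (reps-differ p)
    color-rep-injective (p , suc zero) (_ , suc zero) _  | yes refl = refl , refl

-- The gap between the two chromatic numbers, with blocks of size 3.

square-choosable⇒3m<k : ∀ {m k} → 2 ≤ m → Prime (suc m) → Choosable (square (G (suc m))) k → m * 3 < k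
square-choosable⇒3m<k {m} {k} 2≤m n-prime choosable = ≰⇒> λ k≤3m →
  <⇒≱ 3n<2r (choosable-multipartite (square (G (suc m))) vertex index index-vertex complete k≤3m choosable)
  where
  complete : ∀ {p q} i j → p ≢ q → ¬ ¬ Graph._~_ (square (G (suc m))) (vertex p i) (vertex q j)
  complete i j p≢q = part≢⇒¬¬square n-prime λ eq → p≢q (trans (sym (part-vertex _ i)) (trans eq (part-vertex _ j)))
  step : ∀ m → (suc m + m) * 2 ≡ m + (m * 3 + 2)
  step = solve-∀
  step′ : ∀ m → suc (suc m * 3) ≡ 2 + (m * 3 + 2)
  step′ = solve-∀
  -- In terms of `m` this reads 3m + 3 < 4m + 2, which is where n ≥ 3 enters.
  3n<2r : suc m * 3 < (suc m + m) * 2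
  3n<2r = subst₂ _≤_ (sym (step′ m)) (sym (step m)) (+-monoˡ-≤ (m * 3 + 2) 2≤m)

theorem2p11 : (n : ℕ) .{{_ : NonZero n}} → 3 ≤ n → Prime n →
    ∀ χ χℓ → IsChromaticNumber (square (G n)) χ → IsListChromaticNumber (square (G n)) χℓ →
    + χℓ - + χ ≥ + n - + 1
theorem2p11 (suc m) (s≤s 2≤m) n-prime χ χℓ (_ , χ-least) (choosable , _) =
  -- Since `χ ≤ χℓ`, the integer difference is the truncated one.
  subst (+ m ℤ.≤_) (sym (trans (ℤ.[+m]-[+n]≡m⊖n χℓ χ) (ℤ.⊖-≥ (m+n≤o⇒n≤o m m+χ≤χℓ))))
    (ℤ.+≤+ (m+n≤o⇒m≤o∸n m m+χ≤χℓ))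
  where
  step : ∀ m → m + (suc m + m) ≡ suc (m * 3)
  step = solve-∀
  m+χ≤χℓ : m + χ ≤ χℓ
  m+χ≤χℓ = begin
    -- The upper bound 2m + 1 for `χ` and the lower bound 3m + 1 for `χℓ` differ by exactly `m`,
    -- that is n - 1.
    m + χ           ≤⟨ +-monoʳ-≤ m (χ-least (suc m + m) (square-colorable n-prime)) ⟩
    m + (suc m + m) ≡⟨ step m ⟩
    suc (m * 3)     ≤⟨ square-choosable⇒3m<k 2≤m n-prime choosable ⟩
    χℓ              ∎
    where open ≤-Reasoning
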